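{- Let $G$ be the Steiner graph of a $2$-$(v,k,1)$ design. Then the VC-dimension of $G$ is at most $k(k+1)$.
   Context: All graphs are finite and simple. A $2$-$(v,k,1)$ design is a pair $(\mathcal P,\mathcal B)$ of sets (points and blocks), with $\mathcal B\subseteq 2^{\mathcal P}$, such that $|\mathcal P|=v$, $|B|=k$ for all $B\in\mathcal B$, and for any distinct $p,q\in\mathcal P$ there is a unique $B\in\mathcal B$ with $p,q\in B$. Its Steiner graph has vertex set $\mathcal B$, and two distinct blocks $B,C$ are adjacent if and only if $B\cap C\neq\emptyset$. The VC-dimension of a graph $G$ is the maximum size of a set $S\subseteq V(G)$ that is shattered, meaning that for every $A\subseteq S$ there is a vertex $u\in V(G)$ (possibly $u\in S$) with $N(u)\cap S=A$, where $N(u)$ is the open neighborhood of $u$. -}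

module Defs where

import Data.Bool.Properties as Bool
open import Data.Fin.Base using (Fin)
open import Data.Fin.Properties using (any?)
open import Data.Fin.Subset
  using (Subset; inside; outside; _∈_; _⊆_; _∩_; ∣_∣; Nonempty)
open import Data.Fin.Subset.Properties
  using (_⊆?_; nonempty?; anySubset?; ∩-comm)
open import Data.List.Base using (List; []; _∷_; _++_; map; filter; length; lookup)
open import Data.List.Extrema.Nat using (max; xs≤max; argmax-sel)
open import Data.List.Membership.Propositional renaming (_∈_ to _∈ˡ_) using ()
open import Data.List.Membership.Propositional.Properties
  using (∈-++⁺ˡ; ∈-++⁺ʳ; ∈-map⁺; ∈-map⁻; ∈-filter⁺; ∈-filter⁻)
open import Data.List.Relation.Unary.All as All using ()
open import Data.List.Relation.Unary.Any using (here)
open import Data.List.Relation.Unary.Unique.Propositional using (Unique)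
open import Data.Nat.Base using (ℕ; zero; suc; _≤_)
open import Data.Nat.Properties using (n≤0⇒n≡0)
open import Data.Product using (_×_; _,_; ∃; ∃!; proj₁; proj₂)
open import Data.Sum.Base using (inj₁; inj₂)
open import Data.Vec.Base using ([]; _∷_; tabulate)
open import Data.Vec.Properties using (≡-dec)
open import Function.Base using (id)
open import Relation.Binary.Core using (Rel)
open import Relation.Binary.Definitions
  using (Decidable; DecidableEquality; Irreflexive; Symmetric)
open import Relation.Binary.PropositionalEquality
  using (_≡_; _≢_; refl; sym; subst; trans)
open import Relation.Nullary.Decidable
  using (Dec; does; yes; no; ¬?; _×-dec_; _→-dec_; decidable-stable)
open import Relation.Unary using () renaming (Decidable to Decidable₁)
open import Level using (0ℓ)

_≟ˢ_ : ∀ {n} → DecidableEquality (Subset n)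
_≟ˢ_ = ≡-dec Bool._≟_

allSubset? : ∀ {n} {P : Subset n → Set} → Decidable₁ P → Dec (∀ A → P A)
allSubset? P? with anySubset? (λ A → ¬? (P? A))
... | yes (A , ¬PA) = no (λ all → ¬PA (all A))
... | no  none      = yes (λ A → decidable-stable (P? A) (λ ¬PA → none (A , ¬PA)))

subsets : ∀ n → List (Subset n)
subsets zero    = [] ∷ []
subsets (suc n) = map (outside ∷_) (subsets n) ++ map (inside ∷_) (subsets n)

∈-subsets : ∀ {n} (S : Subset n) → S ∈ˡ subsets n
∈-subsets []            = here refl
∈-subsets (outside ∷ S) = ∈-++⁺ˡ (∈-map⁺ (outside ∷_) (∈-subsets S))
∈-subsets {suc n} (inside ∷ S) =
  ∈-++⁺ʳ (map (outside ∷_) (subsets n)) (∈-map⁺ (inside ∷_) (∈-subsets S))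

-- Finite simple graphs on the vertex set Fin n.
record Graph (n : ℕ) : Set₁ where
  field
    Adj    : Rel (Fin n) 0ℓ
    adj?   : Decidable Adj
    irrefl : Irreflexive _≡_ Adj
    symm   : Symmetric Adj

module _ {n : ℕ} (G : Graph n) where
  open Graph G

  neighbourhood : Fin n → Subset n
  neighbourhood u = tabulate (λ w → does (adj? u w))

  Shattered : Subset n → Set
  Shattered S = ∀ A → A ⊆ S → ∃ λ u → neighbourhood u ∩ S ≡ A

  shattered? : Decidable₁ Shattered
  shattered? S =
    allSubset? (λ A → (A ⊆? S) →-dec any? (λ u → (neighbourhood u ∩ S) ≟ˢ A))

  -- The only graph without a shattered set (not even the empty one) is the
  -- graph with no vertices, whose VC-dimension is 0 by convention.
  vcDim : ℕ
  vcDim = max 0 (map ∣_∣ (filter shattered? (subsets n)))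

  shattered⇒∣S∣≤vcDim : ∀ {S} → Shattered S → ∣ S ∣ ≤ vcDim
  shattered⇒∣S∣≤vcDim {S} sh =
    All.lookup (xs≤max 0 (map ∣_∣ (filter shattered? (subsets n))))
      (∈-map⁺ ∣_∣ (∈-filter⁺ shattered? (∈-subsets S) sh))

  vcDim-attained : ∃ Shattered → ∃ λ S → Shattered S × ∣ S ∣ ≡ vcDim
  vcDim-attained (S₀ , sh₀)
    with argmax-sel id 0 (map ∣_∣ (filter shattered? (subsets n)))
  ... | inj₁ vc≡0 =
    S₀ , sh₀ ,
    trans (n≤0⇒n≡0 (subst (∣ S₀ ∣ ≤_) vc≡0 (shattered⇒∣S∣≤vcDim sh₀))) (sym vc≡0)
  ... | inj₂ vc∈ with ∈-map⁻ ∣_∣ vc∈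
  ...   | S , S∈ , vc≡∣S∣ =
    S , proj₂ (∈-filter⁻ shattered? {xs = subsets n} S∈) , sym vc≡∣S∣

-- 2-(v,k,1) designs on the point set Fin v.  The set of blocks is given by a
-- duplicate-free list.
record Design (v k : ℕ) : Set where
  field
    blocks     : List (Subset v)
    unique     : Unique blocks
    block-size : ∀ {B} → B ∈ˡ blocks → ∣ B ∣ ≡ k
    join       : ∀ {p q} → p ≢ q → ∃! _≡_ λ B → B ∈ˡ blocks × p ∈ B × q ∈ B

-- The vertex i stands for the i-th block; since the list of blocks is
-- duplicate-free, vertices correspond bijectively to blocks.
steinerGraph : ∀ {v k} (D : Design v k) → Graph (length (Design.blocks D))
steinerGraph D = record
  { Adj    = λ i j → block i ≢ block j × Nonempty (block i ∩ block j)
  ; adj?   = λ i j → ¬? (block i ≟ˢ block j) ×-dec nonempty? (block i ∩ block j)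
  ; irrefl = λ { refl (B≢B , _) → B≢B refl }
  ; symm   = λ { {i} {j} (B≢C , ne) →
      (λ C≡B → B≢C (sym C≡B)) , subst Nonempty (∩-comm (block i) (block j)) ne }
  }
  where
  block = lookup (Design.blocks D)

{-# OPTIONS --safe #-}

-- Let S be shattered with |S| > k(k+1).  The block U adjacent to all of S has
-- k points, so some point p lies on at least k+2 blocks of S.  Choose k+1 of
-- them as A, a further one B, and D ∈ S outside A ∪ {B}; this is possible as
-- k ≥ 2, since distinct blocks meet.  A block that meets every member of A must
-- contain p: otherwise two members of A would share a second point.  So a block
-- tracing A or A ∪ {D} on S contains p without being adjacent to B, hence
-- equals B.  But then D is both a neighbour of B and not.
module Submission where

open import Defs
open import Data.Fin.Base using (Fin; zero; suc)
open import Data.Fin.Subset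
  using (Subset; inside; outside; _∈_; _∉_; _⊆_; _∩_; _∪_; _─_; ⁅_⁆; ⊥; ∣_∣; Nonempty)
open import Data.Fin.Subset.Properties
open import Data.List.Base using (List; _∷_; lookup)
open import Data.List.Extrema.Nat using (max≤v⁺)
open import Data.List.Membership.Propositional.Properties using (∈-lookup)
import Data.List.Relation.Unary.All as All
import Data.List.Relation.Unary.All.Properties as All
import Data.List.Relation.Unary.AllPairs as AllPairs
open import Data.List.Relation.Unary.Unique.Propositional using (Unique)
open import Data.Nat.Base using (ℕ; zero; suc; _+_; _*_; _≤_; _<_; z≤n; s≤s; s≤s⁻¹)
open import Data.Nat.Properties
open import Data.Product using (_×_; _,_; ∃)
open import Data.Sum.Base using ([_,_]′)
open import Data.Vec.Base using ([]; _∷_; here; there; tabulate)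
open import Data.Vec.Properties using (lookup∘tabulate; []=⇒lookup; lookup⇒[]=)
open import Function.Base using (_∘_)
open import Relation.Binary.PropositionalEquality
open import Relation.Nullary.Decidable
  using (does; yes; no; dec-true; dec-false; decidable-stable)
open import Relation.Nullary.Negation using (¬_; contradiction)
open import Relation.Unary using () renaming (Decidable to Decidable₁)

private variable
  n v k : ℕ

∣p∣≤∣p∩q∣+∣p─q∣ : ∀ (p q : Subset n) → ∣ p ∣ ≤ ∣ p ∩ q ∣ + ∣ p ─ q ∣
∣p∣≤∣p∩q∣+∣p─q∣ []            []            = z≤n
∣p∣≤∣p∩q∣+∣p─q∣ (outside ∷ p) (outside ∷ q) = ∣p∣≤∣p∩q∣+∣p─q∣ p q
∣p∣≤∣p∩q∣+∣p─q∣ (outside ∷ p) (inside  ∷ q) = ∣p∣≤∣p∩q∣+∣p─q∣ p q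
∣p∣≤∣p∩q∣+∣p─q∣ (inside  ∷ p) (inside  ∷ q) = s≤s (∣p∣≤∣p∩q∣+∣p─q∣ p q)
∣p∣≤∣p∩q∣+∣p─q∣ (inside  ∷ p) (outside ∷ q) =
  ≤-trans (s≤s (∣p∣≤∣p∩q∣+∣p─q∣ p q)) (≤-reflexive (sym (+-suc _ _)))

∣p∪q∣≤∣p∣+∣q∣ : ∀ (p q : Subset n) → ∣ p ∪ q ∣ ≤ ∣ p ∣ + ∣ q ∣
∣p∪q∣≤∣p∣+∣q∣ []            []            = z≤n
∣p∪q∣≤∣p∣+∣q∣ (outside ∷ p) (outside ∷ q) = ∣p∪q∣≤∣p∣+∣q∣ p q
∣p∪q∣≤∣p∣+∣q∣ (outside ∷ p) (inside  ∷ q) =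
  ≤-trans (s≤s (∣p∪q∣≤∣p∣+∣q∣ p q)) (≤-reflexive (sym (+-suc _ _)))
∣p∪q∣≤∣p∣+∣q∣ (inside  ∷ p) (outside ∷ q) = s≤s (∣p∪q∣≤∣p∣+∣q∣ p q)
∣p∪q∣≤∣p∣+∣q∣ (inside  ∷ p) (inside  ∷ q) =
  s≤s (≤-trans (∣p∪q∣≤∣p∣+∣q∣ p q) (+-monoʳ-≤ ∣ p ∣ (n≤1+n ∣ q ∣)))

x∈p─q⇒x∉q : ∀ {x} (p q : Subset n) → x ∈ p ─ q → x ∉ q
x∈p─q⇒x∉q (_ ∷ p) (inside  ∷ q) (there x∈p─q) (there x∈q) = x∈p─q⇒x∉q p q x∈p─q x∈q
x∈p─q⇒x∉q (_ ∷ p) (outside ∷ q) (there x∈p─q) (there x∈q) = x∈p─q⇒x∉q p q x∈p─q x∈q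

∣p∣<∣q∣⇒∃∈q∉p : ∀ (p q : Subset n) → ∣ p ∣ < ∣ q ∣ → ∃ λ x → x ∈ q × x ∉ p
∣p∣<∣q∣⇒∃∈q∉p p q ∣p∣<∣q∣ with nonempty? (q ─ p)
... | yes (x , x∈q─p) = x , p─q⊆p q p x∈q─p , x∈p─q⇒x∉q q p x∈q─p
... | no  q─p≡∅ = contradiction ∣p∣<∣q∣ (≤⇒≯ (p⊆q⇒∣p∣≤∣q∣ λ {x} x∈q →
  decidable-stable (x ∈? p) λ x∉p → q─p≡∅ (x , x∈p∧x∉q⇒x∈p─q x∈q x∉p)))

0<∣p∣⇒nonempty : ∀ (p : Subset n) → 0 < ∣ p ∣ → ∃ (_∈ p)
0<∣p∣⇒nonempty {n} p 0<∣p∣ =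
  let x , x∈p , _ = ∣p∣<∣q∣⇒∃∈q∉p ⊥ p (subst (_< ∣ p ∣) (sym (∣⊥∣≡0 n)) 0<∣p∣)
  in x , x∈p

1<∣p∣⇒distinct : ∀ (p : Subset n) → 1 < ∣ p ∣ → ∃ λ x → ∃ λ y → x ∈ p × y ∈ p × y ≢ x
1<∣p∣⇒distinct p 1<∣p∣ =
  let x , x∈p = 0<∣p∣⇒nonempty p (<⇒≤ 1<∣p∣)
      y , y∈p , y∉⁅x⁆ = ∣p∣<∣q∣⇒∃∈q∉p ⁅ x ⁆ p (subst (_< ∣ p ∣) (sym (∣⁅x⁆∣≡1 x)) 1<∣p∣)
  in x , y , x∈p , y∈p , x∉⁅y⁆⇒x≢y y∉⁅x⁆

-- An element of `p` missing from `q` would differ from `x`, so `⁅ x ⁆` would be a proper subset of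
-- `p`. For blocks of size at most 1 this turns meeting into coinciding.
∣p∣≤1⇒p⊆q : ∀ {x} {p q : Subset n} → ∣ p ∣ ≤ 1 → x ∈ p → x ∈ q → p ⊆ q
∣p∣≤1⇒p⊆q {x = x} {p} {q} ∣p∣≤1 x∈p x∈q {y} y∈p =
  decidable-stable (y ∈? q) λ y∉q → contradiction ∣p∣≤1 (<⇒≱
    (subst (_< ∣ p ∣) (∣⁅x⁆∣≡1 x) (p⊂q⇒∣p∣<∣q∣
      ( (λ z∈⁅x⁆ → subst (_∈ p) (sym (x∈⁅y⁆⇒x≡y x z∈⁅x⁆)) x∈p)
      , y , y∈p , λ y∈⁅x⁆ → y∉q (subst (_∈ q) (sym (x∈⁅y⁆⇒x≡y x y∈⁅x⁆)) x∈q)))))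

p∪⁅x⁆⊆q : ∀ {x} {p q : Subset n} → p ⊆ q → x ∈ q → p ∪ ⁅ x ⁆ ⊆ q
p∪⁅x⁆⊆q {x = x} {p} {q} p⊆q x∈q y∈ =
  [ p⊆q , (λ y∈⁅x⁆ → subst (_∈ q) (sym (x∈⁅y⁆⇒x≡y x y∈⁅x⁆)) x∈q) ]′ (x∈p∪q⁻ p ⁅ x ⁆ y∈)

subsetOfSize : ∀ m (p : Subset n) → m ≤ ∣ p ∣ → ∃ λ q → q ⊆ p × ∣ q ∣ ≡ m
subsetOfSize {n} zero p _ = ⊥ , ⊥⊆ , ∣⊥∣≡0 n
subsetOfSize (suc m) (outside ∷ p) m<∣p∣ =
  let q , q⊆p , ∣q∣≡ = subsetOfSize (suc m) p m<∣p∣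
  in outside ∷ q , s⊆s q⊆p , ∣q∣≡
subsetOfSize (suc m) (inside ∷ p) m<∣p∣ =
  let q , q⊆p , ∣q∣≡ = subsetOfSize m p (s≤s⁻¹ m<∣p∣)
  in inside ∷ q , s⊆s q⊆p , cong suc ∣q∣≡

-- Induction on `U`: a class `F zero` holding at most `c` elements of `S` is deleted from `S`, and
-- the rest is still too large for the remaining points. The classes may overlap.
pigeonhole : ∀ c (F : Fin v → Subset n) (U : Subset v) (S : Subset n) →
  (∀ {i} → i ∈ S → ∃ λ p → p ∈ U × i ∈ F p) →
  ∣ U ∣ * c < ∣ S ∣ → ∃ λ p → p ∈ U × c < ∣ S ∩ F p ∣
pigeonhole c F [] S cover large with 0<∣p∣⇒nonempty S large
... | i , i∈S with () , _ ← cover i∈S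
pigeonhole c F (outside ∷ U) S cover large =
  let p , p∈U , many = pigeonhole c (F ∘ suc) U S cover′ large
  in suc p , there p∈U , many
  where
  cover′ : ∀ {i} → i ∈ S → ∃ λ p → p ∈ U × i ∈ F (suc p)
  cover′ i∈S with cover i∈S
  ... | suc p , there p∈U , i∈Fp = p , p∈U , i∈Fp
pigeonhole c F (inside ∷ U) S cover large with c <? ∣ S ∩ F zero ∣
... | yes many = zero , here , many
... | no  few  =
  let p , p∈U , many = pigeonhole c (F ∘ suc) U (S ─ F zero) cover′ large′
  in suc p , there p∈U , <-≤-trans many (p⊆q⇒∣p∣≤∣q∣ λ i∈ →
       let i∈S─F₀ , i∈Fp = x∈p∩q⁻ (S ─ F zero) (F (suc p)) i∈
       in x∈p∩q⁺ (p─q⊆p S (F zero) i∈S─F₀ , i∈Fp))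
  where
  cover′ : ∀ {i} → i ∈ S ─ F zero → ∃ λ p → p ∈ U × i ∈ F (suc p)
  cover′ i∈S─F₀ with cover (p─q⊆p S (F zero) i∈S─F₀)
  ... | zero  , _         , i∈F₀ = contradiction i∈F₀ (x∈p─q⇒x∉q S (F zero) i∈S─F₀)
  ... | suc p , there p∈U , i∈Fp = p , p∈U , i∈Fp

  large′ : ∣ U ∣ * c < ∣ S ─ F zero ∣
  -- Here `large` computes to `c + ∣ U ∣ * c < ∣ S ∣`; the summand `c` pays for the deleted class.
  large′ = +-cancelˡ-< c _ _ (<-≤-trans large
    (≤-trans (∣p∣≤∣p∩q∣+∣p─q∣ S (F zero)) (+-monoˡ-≤ ∣ S ─ F zero ∣ (≮⇒≥ few))))

module _ {P : Fin n → Set} (P? : Decidable₁ P) where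

  -- The form `tabulate (does ∘ P?)` is common to `neighbourhood` and `blocksThrough`.
  ∈-tabulate⁺ : ∀ {i} → P i → i ∈ tabulate (does ∘ P?)
  ∈-tabulate⁺ {i} Pi =
    lookup⇒[]= i _ (trans (lookup∘tabulate (does ∘ P?) i) (dec-true (P? i) Pi))

  ∈-tabulate⁻ : ∀ {i} → i ∈ tabulate (does ∘ P?) → P i
  ∈-tabulate⁻ {i} i∈ = decidable-stable (P? i) λ ¬Pi → contradiction
    (trans (sym (dec-false (P? i) ¬Pi))
      (trans (sym (lookup∘tabulate (does ∘ P?) i)) ([]=⇒lookup i∈)))
    λ ()

-- Vertices are indices, while `join` speaks of the blocks themselves; this leads from equal blocks
-- back to equal vertices.
lookup-injective : ∀ {A : Set} {xs : List A} → Unique xs →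
  ∀ i j → lookup xs i ≡ lookup xs j → i ≡ j
lookup-injective {xs = _ ∷ _} _ zero zero _ = refl
lookup-injective {xs = _ ∷ xs} (x∉xs AllPairs.∷ _) zero (suc j) eq =
  contradiction eq (All.lookup x∉xs (∈-lookup {xs = xs} j))
lookup-injective {xs = _ ∷ xs} (x∉xs AllPairs.∷ _) (suc i) zero eq =
  contradiction (sym eq) (All.lookup x∉xs (∈-lookup {xs = xs} i))
lookup-injective {xs = _ ∷ _} (_ AllPairs.∷ xs!) (suc i) (suc j) eq =
  cong suc (lookup-injective xs! i j eq)

module _ (G : Graph n) where
  open Graph G

  -- The two inclusions of `neighbourhood G u ∩ S ≡ A`. The second serves mostly in contraposed
  -- form: `u` is not adjacent to members of `S` outside `A`.
  shattered-trace : ∀ {S A} → Shattered G S → A ⊆ S →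
    ∃ λ u → (∀ {w} → w ∈ A → Adj u w) × (∀ {w} → w ∈ S → Adj u w → w ∈ A)
  shattered-trace {S} {A} sh A⊆S =
    let u , N∩S≡A = sh A A⊆S
    in u
     , (λ w∈A → ∈-tabulate⁻ (adj? u)
         (p∩q⊆p (neighbourhood G u) S (subst (_ ∈_) (sym N∩S≡A) w∈A)))
     , (λ w∈S adj → subst (_ ∈_) N∩S≡A (x∈p∩q⁺ (∈-tabulate⁺ (adj? u) adj , w∈S)))

  vcDim≤ : ∀ {m} → (∀ {S} → Shattered G S → ∣ S ∣ ≤ m) → vcDim G ≤ m
  -- `z≤n` covers the default value 0 of `max`; every other entry is the size of a set that passed
  -- the filter.
  vcDim≤ bound = max≤v⁺ z≤n
    (All.map⁺ (All.map bound (All.all-filter (shattered? G) (subsets _))))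

module _ (D : Design v k) where
  open Design D
  open Graph (steinerGraph D)

  block = lookup blocks

  ∣block∣≡k : ∀ i → ∣ block i ∣ ≡ k
  ∣block∣≡k i = block-size (∈-lookup {xs = blocks} i)

  blocksThrough : Fin v → Subset _
  blocksThrough p = tabulate (λ i → does (p ∈? block i))

  ∈-blocksThrough⁺ : ∀ {p i} → p ∈ block i → i ∈ blocksThrough p
  ∈-blocksThrough⁺ {p} = ∈-tabulate⁺ (λ i → p ∈? block i)

  ∈-blocksThrough⁻ : ∀ {p i} → i ∈ blocksThrough p → p ∈ block i
  ∈-blocksThrough⁻ {p} = ∈-tabulate⁻ (λ i → p ∈? block i)

  two-points-determine : ∀ {p q i j} → p ≢ q →
    p ∈ block i → q ∈ block i → p ∈ block j → q ∈ block j → i ≡ j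
  two-points-determine {i = i} {j} p≢q p∈i q∈i p∈j q∈j =
    let _ , _ , only = join p≢q
    in lookup-injective unique i j (trans
         (sym (only (∈-lookup {xs = blocks} i , p∈i , q∈i)))
         (only (∈-lookup {xs = blocks} j , p∈j , q∈j)))

  adjacent⇒meet : ∀ {u i} → Adj u i → ∃ λ p → p ∈ block u × i ∈ blocksThrough p
  adjacent⇒meet {u} {i} (_ , p , p∈) =
    let p∈u , p∈i = x∈p∩q⁻ (block u) (block i) p∈
    in p , p∈u , ∈-blocksThrough⁺ p∈i

  -- Adjacent blocks share a point; if they had at most one point each, they would be equal,
  -- contrary to the first component of `Adj`.
  adjacent⇒2≤k : ∀ {u i} → Adj u i → 2 ≤ k
  adjacent⇒2≤k {u} {i} adj@(u≢i , _) = ≰⇒> λ k≤1 →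
    let p , p∈u , p∈i = adjacent⇒meet adj
        small j = ≤-trans (≤-reflexive (∣block∣≡k j)) k≤1
    in u≢i (⊆-antisym
         (∣p∣≤1⇒p⊆q (small u) p∈u (∈-blocksThrough⁻ p∈i))
         (∣p∣≤1⇒p⊆q (small i) (∈-blocksThrough⁻ p∈i) p∈u))

  meets-many⇒through : ∀ {p A w} → A ⊆ blocksThrough p → k < ∣ A ∣ →
    (∀ {i} → i ∈ A → Adj w i) → p ∈ block w
  meets-many⇒through {p} {A} {w} A⊆Fp k<∣A∣ adj = decidable-stable (p ∈? block w) λ p∉w →
    -- More than `k` blocks of `A` meet the `k` points of `block w`, so pigeonhole with `c = 1` puts
    -- two of them through one point `q`. Since `p∉w`, this `q` is not `p`, and the two blocks share
    -- both points.
    let q , q∈w , many = pigeonhole 1 blocksThrough (block w) A (adjacent⇒meet ∘ adj)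
          (subst (_< ∣ A ∣) (sym (trans (*-identityʳ _) (∣block∣≡k w))) k<∣A∣)
        i , j , i∈ , j∈ , j≢i = 1<∣p∣⇒distinct (A ∩ blocksThrough q) many
        i∈A , i∈Fq = x∈p∩q⁻ A (blocksThrough q) i∈
        j∈A , j∈Fq = x∈p∩q⁻ A (blocksThrough q) j∈
    in j≢i (two-points-determine (λ p≡q → p∉w (subst (_∈ block w) (sym p≡q) q∈w))
         (∈-blocksThrough⁻ (A⊆Fp j∈A)) (∈-blocksThrough⁻ j∈Fq)
         (∈-blocksThrough⁻ (A⊆Fp i∈A)) (∈-blocksThrough⁻ i∈Fq))

  -- With a common point `p` given, only the inequality in `Adj` can fail.
  through∧nonadjacent⇒≡ : ∀ {p w i} → p ∈ block w → p ∈ block i → ¬ Adj w i →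
    block w ≡ block i
  through∧nonadjacent⇒≡ {p} {w} {i} p∈w p∈i ¬adj =
    decidable-stable (block w ≟ˢ block i) λ w≢i → ¬adj (w≢i , p , x∈p∩q⁺ (p∈w , p∈i))

  shattered⇒no-extension : ∀ {p S A b d} → Shattered (steinerGraph D) S →
    A ⊆ S → A ⊆ blocksThrough p → k < ∣ A ∣ →
    b ∈ S → b ∈ blocksThrough p → b ∉ A → d ∈ S → ¬ d ∉ A ∪ ⁅ b ⁆
  shattered⇒no-extension {p} {S} {A} {b} {d} sh A⊆S A⊆Fp k<∣A∣ b∈S b∈Fp b∉A d∈S d∉A∪b
    with w , adj-w , only-w ← shattered-trace (steinerGraph D) sh A⊆S
       | x , adj-x , only-x ← shattered-trace (steinerGraph D) sh (p∪⁅x⁆⊆q A⊆S d∈S)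
    -- Both `w`, tracing `A`, and `x`, tracing `A ∪ ⁅ d ⁆`, have the block of `b`. Adjacency depends
    -- on the blocks alone, so it passes from `x` and `d` to `w` and `d`, which forces `d` into `A`.
    = d∉A (only-w d∈S (subst (λ B → B ≢ block d × Nonempty (B ∩ block d))
        (trans (is-b (adj-x ∘ p⊆p∪q ⁅ d ⁆) (b∉A∪d ∘ only-x b∈S))
          (sym (is-b adj-w (b∉A ∘ only-w b∈S))))
        (adj-x (q⊆p∪q A ⁅ d ⁆ (x∈⁅x⁆ d)))))
    where
    d∉A : d ∉ A
    d∉A = d∉A∪b ∘ p⊆p∪q ⁅ b ⁆

    -- Besides `d∉A`, the hypothesis `d∉A∪b` yields that `d` and `b` differ.
    b∉A∪d : b ∉ A ∪ ⁅ d ⁆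
    b∉A∪d = [ b∉A , (λ b∈d → d∉A∪b (q⊆p∪q A ⁅ b ⁆
      (subst (_∈ ⁅ b ⁆) (x∈⁅y⁆⇒x≡y d b∈d) (x∈⁅x⁆ b)))) ]′ ∘ x∈p∪q⁻ A ⁅ d ⁆

    is-b : ∀ {w} → (∀ {i} → i ∈ A → Adj w i) → ¬ Adj w b → block w ≡ block b
    is-b adj = through∧nonadjacent⇒≡
      (meets-many⇒through {p} A⊆Fp k<∣A∣ adj) (∈-blocksThrough⁻ b∈Fp)

  shattered⇒popular-point : ∀ {S} → Shattered (steinerGraph D) S → k * (k + 1) < ∣ S ∣ →
    2 ≤ k × ∃ λ p → k + 1 < ∣ S ∩ blocksThrough p ∣
  shattered⇒popular-point {S} sh large
    -- Tracing `S` itself gives a vertex `u` adjacent to all of `S`, so the `k` points of `block u`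
    -- cover `S`. The member `s` supplies an actual adjacency, from which `2 ≤ k` follows.
    with u , adj , _ ← shattered-trace (steinerGraph D) sh (⊆-refl {x = S})
       | s , s∈S ← 0<∣p∣⇒nonempty S (≤-<-trans z≤n large)
    with p , _ , many ← pigeonhole (k + 1) blocksThrough (block u) S (adjacent⇒meet ∘ adj)
           (subst (λ m → m * (k + 1) < ∣ S ∣) (sym (∣block∣≡k u)) large)
    = adjacent⇒2≤k (adj s∈S) , p , many

  shattered⇒∣S∣≤k*[k+1] : ∀ {S} → Shattered (steinerGraph D) S → ∣ S ∣ ≤ k * (k + 1)
  shattered⇒∣S∣≤k*[k+1] {S} sh = ≮⇒≥ too-large
    where
    open ≤-Reasoning

    too-large : ¬ k * (k + 1) < ∣ S ∣
    too-large large with 2≤k , p , many ← shattered⇒popular-point sh large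
      -- Size `k + 1` exceeds the number of points of a block, as `meets-many⇒through` requires, and
      -- still leaves a further block `b` of `S` through `p`.
      with A , A⊆T , ∣A∣≡k+1 ← subsetOfSize (k + 1) (S ∩ blocksThrough p) (<⇒≤ many)
      with b , b∈T , b∉A ← ∣p∣<∣q∣⇒∃∈q∉p A (S ∩ blocksThrough p)
             (subst (_< ∣ S ∩ blocksThrough p ∣) (sym ∣A∣≡k+1) many)
      with d , d∈S , d∉A∪b ← ∣p∣<∣q∣⇒∃∈q∉p (A ∪ ⁅ b ⁆) S (begin-strict
             ∣ A ∪ ⁅ b ⁆ ∣      ≤⟨ ∣p∪q∣≤∣p∣+∣q∣ A ⁅ b ⁆ ⟩
             ∣ A ∣ + ∣ ⁅ b ⁆ ∣  ≡⟨ cong₂ _+_ ∣A∣≡k+1 (∣⁅x⁆∣≡1 b) ⟩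
             k + 1 + 1          ≤⟨ +-monoʳ-≤ (k + 1) (≤-trans (m≤n+m 1 k) (m≤m+n (k + 1) 0)) ⟩
             -- Here `2 ≤ k` enters: it leaves room in `S` for a `d` beyond the `k + 2` blocks
             -- already chosen.
             2 * (k + 1)        ≤⟨ *-monoˡ-≤ (k + 1) 2≤k ⟩
             k * (k + 1)        <⟨ large ⟩
             ∣ S ∣              ∎)
      = shattered⇒no-extension {p} sh
          (p∩q⊆p S (blocksThrough p) ∘ A⊆T) (p∩q⊆q S (blocksThrough p) ∘ A⊆T)
          (≤-reflexive (trans (+-comm 1 k) (sym ∣A∣≡k+1)))
          (p∩q⊆p S (blocksThrough p) b∈T) (p∩q⊆q S (blocksThrough p) b∈T) b∉A
          d∈S d∉A∪b

theorem39 : ∀ (v k : ℕ) (D : Design v k) → vcDim (steinerGraph D) ≤ k * (k + 1)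
theorem39 v k D = vcDim≤ (steinerGraph D) (shattered⇒∣S∣≤k*[k+1] D)
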